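{- Let $(F_n(X,Y))_{n\ge 0}$ be a sequence of nonzero polynomials with non-negative integer coefficients such that $F_n(0,0)=0$ for every $n\ge 0$. Define $(x_n)_{n\ge 0}$ by $x_0=1$, $x_1\in\mathbb{Z}_{>0}$ and $$x_{n+2}x_n=x_{n+1}^2\bigl(F_n(x_n,x_{n+1})+1\bigr)\qquad(n\ge 0).$$ Then for any positive integer $h$, the alternating series $T=\sum_{n=0}^{\infty}(-1)^n\frac{h^n}{x_{n+1}}$ has the infinite continued fraction expansion $$T=\cfrac{a_1}{b_1+\cfrac{a_2}{b_2+\cfrac{a_3}{b_3+\cdots}}},$$ where $$a_1=1,\quad a_2=hx_1,\quad a_3=h,\quad a_4=x_1,$$ $$b_1=x_1,\quad b_2=\frac{x_2}{x_1}-h,\quad b_3=F_1(x_1,x_2)+1-x_1,\quad b_4=1,$$ and for $k\ge 2$ $$a_{3k-1}=h^k,\quad a_{3k}=h^{k-1},\quad a_{3k+1}=1,$$ $$b_{3k-1}=h^{k-1}(x_k-h),\quad b_{3k}=\frac{F_k(x_k,x_{k+1})}{x_k}-1,\quad b_{3k+1}=1.$$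
   Context: The value of an infinite continued fraction with partial numerators $a_m$ and partial denominators $b_m$ is $\lim_{m\to\infty}P_m/Q_m$, where $P_0=0$, $Q_0=1$, $P_1=a_1$, $Q_1=b_1$, and $P_{k+2}=b_{k+2}P_{k+1}+a_{k+2}P_k$, $Q_{k+2}=b_{k+2}Q_{k+1}+a_{k+2}Q_k$ for $k\ge 0$ (the limit being taken over $m$ large enough that $Q_m\ne 0$). -}

module Defs where

open import Data.Nat.Base as ℕ using (ℕ; zero; suc)
open import Data.Integer.Base using (+_)
open import Data.List.Base using (List; []; _∷_)
open import Data.List.Relation.Unary.Any using (Any)
open import Data.Product.Base using (∃-syntax; _×_)
open import Data.Rational.Base
open import Data.Rational.Properties using (_≟_)
open import Relation.Binary.PropositionalEquality using (_≡_; _≢_)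
open import Relation.Nullary.Decidable using (yes; no)

open import Algebra.Definitions.RawSemiring +-*-rawSemiring public using (_^_)

fromℕ : ℕ → ℚ
fromℕ n = + n / 1

-- Total division, with the convention p ⊘ 0 = 0.
infixl 7 _⊘_
_⊘_ : ℚ → ℚ → ℚ
p ⊘ q with q ≟ 0ℚ
... | yes _  = 0ℚ
... | no q≢0 = _÷_ p q {{≢-nonZero q≢0}}

-- ℕ[X,Y] by coefficients: entry j of entry i of the list is the
-- coefficient of XⁱYʲ. Trailing zeros are allowed.
Poly₁ Poly₂ : Set
Poly₁ = List ℕ
Poly₂ = List Poly₁

NonzeroPoly : Poly₂ → Set
NonzeroPoly = Any (Any (_≢ 0))

eval₁ : Poly₁ → ℚ → ℚ
eval₁ []       y = 0ℚ
eval₁ (c ∷ cs) y = fromℕ c + y * eval₁ cs y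

eval₂ : Poly₂ → ℚ → ℚ → ℚ
eval₂ []       x y = 0ℚ
eval₂ (p ∷ ps) x y = eval₁ p y + x * eval₂ ps x y

-- Real numbers, as Cauchy sequences of rationals.
record ℝ : Set where
  field
    approx : ℕ → ℚ
    cauchy : ∀ ε → 0ℚ < ε →
             ∃[ N ] (∀ m n → N ℕ.≤ m → N ℕ.≤ n → ∣ approx m - approx n ∣ < ε)

-- The real inequality |q − T| < ε: some rational δ < ε eventually bounds
-- the distance from q to the approximations of T.
∣_-_∣<_ : ℚ → ℝ → ℚ → Set
∣ q - T ∣< ε =
  ∃[ δ ] (δ < ε × ∃[ K ] (∀ j → K ℕ.≤ j → ∣ q - ℝ.approx T j ∣ ≤ δ))

infix 4 _⟶_
_⟶_ : (ℕ → ℚ) → ℝ → Set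
s ⟶ T = ∀ ε → 0ℚ < ε → ∃[ N ] (∀ n → N ℕ.≤ n → ∣ s n - T ∣< ε)

partialSum : (ℕ → ℚ) → ℕ → ℚ
partialSum f zero    = 0ℚ
partialSum f (suc n) = partialSum f n + f n

HasSum : (ℕ → ℚ) → ℝ → Set
HasSum f T = partialSum f ⟶ T

-- Convergents of a₁/(b₁ + a₂/(b₂ + ⋯)); the values a 0 and b 0 are unused.
module _ (a b : ℕ → ℚ) where

  P : ℕ → ℚ
  P 0             = 0ℚ
  P 1             = a 1
  P (suc (suc k)) = b (2 ℕ.+ k) * P (suc k) + a (2 ℕ.+ k) * P k

  Q : ℕ → ℚ
  Q 0             = 1ℚ
  Q 1             = b 1
  Q (suc (suc k)) = b (2 ℕ.+ k) * Q (suc k) + a (2 ℕ.+ k) * Q k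

  HasCFValue : ℝ → Set
  HasCFValue T =
    (∃[ M ] (∀ m → M ℕ.≤ m → Q m ≢ 0ℚ)) × ((λ m → P m ⊘ Q m) ⟶ T)

record IsRecurrence (F : ℕ → Poly₂) (x : ℕ → ℚ) : Set where
  field
    x₀  : x 0 ≡ 1ℚ
    x₁  : ∃[ m ] (0 ℕ.< m × x 1 ≡ fromℕ m)
    rec : ∀ n → x (2 ℕ.+ n) * x n ≡
                x (1 ℕ.+ n) ^ 2 * (eval₂ (F n) (x n) (x (1 ℕ.+ n)) + 1ℚ)

-- Every index m ≥ 5 is uniquely 3k − 1, 3k or 3k + 1 with k ≥ 2, so these
-- equations determine a m and b m for all m ≥ 1.
record IsExpansion (F : ℕ → Poly₂) (x : ℕ → ℚ) (h : ℕ) (a b : ℕ → ℚ) : Set where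
  H : ℚ
  H = fromℕ h
  field
    a₁ : a 1 ≡ 1ℚ
    a₂ : a 2 ≡ H * x 1
    a₃ : a 3 ≡ H
    a₄ : a 4 ≡ x 1
    b₁ : b 1 ≡ x 1
    b₂ : b 2 ≡ x 2 ⊘ x 1 - H
    b₃ : b 3 ≡ eval₂ (F 1) (x 1) (x 2) + 1ℚ - x 1
    b₄ : b 4 ≡ 1ℚ
    a₃ₖ₋₁ : ∀ k → 2 ℕ.≤ k → a (3 ℕ.* k ℕ.∸ 1) ≡ H ^ k
    a₃ₖ   : ∀ k → 2 ℕ.≤ k → a (3 ℕ.* k) ≡ H ^ (k ℕ.∸ 1)
    a₃ₖ₊₁ : ∀ k → 2 ℕ.≤ k → a (3 ℕ.* k ℕ.+ 1) ≡ 1ℚ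
    b₃ₖ₋₁ : ∀ k → 2 ℕ.≤ k → b (3 ℕ.* k ℕ.∸ 1) ≡ H ^ (k ℕ.∸ 1) * (x k - H)
    b₃ₖ   : ∀ k → 2 ℕ.≤ k →
            b (3 ℕ.* k) ≡ eval₂ (F k) (x k) (x (1 ℕ.+ k)) ⊘ x k - 1ℚ
    b₃ₖ₊₁ : ∀ k → 2 ℕ.≤ k → b (3 ℕ.* k ℕ.+ 1) ≡ 1ℚ

{-# OPTIONS --safe #-}
module Submission where

-- Put yₙ = xₙ₊₁ / xₙ, let Sₙ be the partial sums of the series, and let W be
-- the numerators P (with s = S) or the denominators Q (with s = 1). Since
-- (sₖ₊₂ − sₖ₊₁) yₖ₊₁ + h (sₖ₊₁ − sₖ) = 0 in both cases, induction on k gives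
--   W₃ₖ   = (Fₖ/xₖ − 1) c xₖ₊₁ sₖ₊₁ + c (yₖ sₖ₊₁ + h sₖ)
--   W₃ₖ₊₁ = c (yₖ₊₁ sₖ₊₂ + h sₖ₊₁)
--   W₃ₖ₊₂ = hᵏ c xₖ₊₂ sₖ₊₂
-- with scales c = cₖ > 0, c₁ = x₁, cₖ₊₁ = hᵏ cₖ. As Fₖ ≥ xₖ, every convergent
-- P/Q from index 3 on is a weighted mean of two consecutive partial sums.
-- These form a Cauchy sequence, because the terms decrease in absolute value
-- by the factor h / yₙ and yₙ ≥ n + 1.

open import Defs
open import Data.Nat.Base as ℕ using (ℕ; zero; suc)
import Data.Nat.Properties as ℕ
import Data.Nat.DivMod as ℕ
import Data.Nat.Coprimality as Coprime
open import Data.Fin.Base using (Fin; zero; suc; toℕ)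
open import Data.Integer.Base as ℤ using (+_; -[1+_]; +≤+)
import Data.Integer.Properties as ℤ
open import Data.List.Base using ([]; _∷_)
open import Data.List.Relation.Unary.Any using (Any; here; there)
open import Data.Product.Base using (∃-syntax; _×_; _,_; proj₁; proj₂)
open import Data.Rational.Base
open import Data.Rational.Properties
open import Data.Rational.Solver using (module +-*-Solver)
open import Relation.Binary.PropositionalEquality using (_≡_; _≢_; refl; sym; trans; cong; cong₂; subst; subst₂; module ≡-Reasoning)
open import Relation.Nullary.Decidable using (yes; no)
open import Relation.Nullary.Negation using (contradiction)

open +-*-Solver

-- Ordered field arithmetic

≤-by : ∀ {p q} r → 0ℚ ≤ r → q ≡ p + r → p ≤ q
≤-by {p} r 0≤r refl = subst (_≤ p + r) (+-identityʳ p) (+-monoʳ-≤ p 0≤r)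

0≤+ : ∀ {p q} → 0ℚ ≤ p → 0ℚ ≤ q → 0ℚ ≤ p + q
0≤+ = +-mono-≤

0≤* : ∀ {p q} → 0ℚ ≤ p → 0ℚ ≤ q → 0ℚ ≤ p * q
0≤* {p} {q} 0≤p 0≤q =
  subst (_≤ p * q) (*-zeroʳ p) (*-monoˡ-≤-nonNeg p {{nonNegative 0≤p}} 0≤q)

0<* : ∀ {p q} → 0ℚ < p → 0ℚ < q → 0ℚ < p * q
0<* {p} {q} 0<p 0<q =
  subst (_< p * q) (*-zeroʳ p) (*-monoʳ-<-pos p {{positive 0<p}} 0<q)

0<1 : 0ℚ < 1ℚ
0<1 = positive⁻¹ 1ℚ

0≤1 : 0ℚ ≤ 1ℚ
0≤1 = <⇒≤ 0<1

0<⇒≢0 : ∀ {p} → 0ℚ < p → p ≢ 0ℚ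
0<⇒≢0 0<p p≡0 = <⇒≢ 0<p (sym p≡0)

0≤- : ∀ {p q} → p ≤ q → 0ℚ ≤ q - p
0≤- {p} {q} p≤q = subst (_≤ q - p) (+-inverseʳ p) (+-monoˡ-≤ (- p) p≤q)

*-cancelʳ-≡ : ∀ {p q r} → 0ℚ < r → p * r ≡ q * r → p ≡ q
*-cancelʳ-≡ {r = r} 0<r eq = ≤-antisym
  (*-cancelʳ-≤-pos r {{positive 0<r}} (≤-reflexive eq))
  (*-cancelʳ-≤-pos r {{positive 0<r}} (≤-reflexive (sym eq)))

⊘-* : ∀ {p q} → q ≢ 0ℚ → (p ⊘ q) * q ≡ p
⊘-* {p} {q} q≢0 with q ≟ 0ℚ
... | yes q≡0 = contradiction q≡0 q≢0
... | no  q≢0 = begin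
  p * 1/ q * q   ≡⟨ *-assoc p (1/ q) q ⟩
  p * (1/ q * q) ≡⟨ cong (p *_) (*-inverseˡ q) ⟩
  p * 1ℚ         ≡⟨ *-identityʳ p ⟩
  p              ∎
  where
    open ≡-Reasoning
    instance _ = ≢-nonZero q≢0

^-pos : ∀ {p} → 0ℚ < p → ∀ n → 0ℚ < p ^ n
^-pos 0<p zero    = 0<1
^-pos 0<p (suc n) = 0<* 0<p (^-pos 0<p n)

∣-1^n∣≡1 : ∀ n → ∣ (- 1ℚ) ^ n ∣ ≡ 1ℚ
∣-1^n∣≡1 zero    = refl
∣-1^n∣≡1 (suc n) = begin
  ∣ - 1ℚ * (- 1ℚ) ^ n ∣     ≡⟨ ∣p*q∣≡∣p∣*∣q∣ (- 1ℚ) ((- 1ℚ) ^ n) ⟩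
  1ℚ * ∣ (- 1ℚ) ^ n ∣       ≡⟨ *-identityˡ _ ⟩
  ∣ (- 1ℚ) ^ n ∣            ≡⟨ ∣-1^n∣≡1 n ⟩
  1ℚ                        ∎
  where open ≡-Reasoning

∣p-q∣≡∣q-p∣ : ∀ p q → ∣ p - q ∣ ≡ ∣ q - p ∣
∣p-q∣≡∣q-p∣ p q = trans (sym (∣-p∣≡∣p∣ (p - q)))
  (cong ∣_∣ (solve 2 (λ p q → :- (p :- q) := q :- p) refl p q))

∣-∣-triangle : ∀ p q r → ∣ p - r ∣ ≤ ∣ p - q ∣ + ∣ q - r ∣
∣-∣-triangle p q r = subst (λ z → ∣ z ∣ ≤ ∣ p - q ∣ + ∣ q - r ∣)
  (solve 3 (λ p q r → (p :- q) :+ (q :- r) := p :- r) refl p q r)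
  (∣p+q∣≤∣p∣+∣q∣ (p - q) (q - r))

-- Ring identities under a hypothesis `l ≡ r`: the solver proves the identity with the multiple
-- `c * (l - r)` added, and that multiple vanishes.
modulo : ∀ {p q l r} c → l ≡ r → p ≡ q + c * (l - r) → p ≡ q
modulo {q = q} {l} c refl refl =
  solve 3 (λ q c l → q :+ c :* (l :- l) := q) refl q c l

-- Multiplying by `q = α + β > 0` turns `p - τ` into `α * (s - τ) + β * (s′ - τ)`, to which the
-- triangle inequality applies.
weighted-mean-close : ∀ {p q s s′ τ α β δ} → 0ℚ < q → 0ℚ ≤ α → 0ℚ ≤ β →
  ∣ s - τ ∣ ≤ δ → ∣ s′ - τ ∣ ≤ δ → p * q ≡ α * s + β * s′ → q ≡ α + β → ∣ p - τ ∣ ≤ δ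
weighted-mean-close {p} {_} {s} {s′} {τ} {α} {β} {δ} 0<q 0≤α 0≤β s≈τ s′≈τ pq≡ refl =
  *-cancelʳ-≤-pos (α + β) {{positive 0<q}} (begin
    ∣ p - τ ∣ * (α + β)
      ≡⟨ cong (∣ p - τ ∣ *_) (0≤p⇒∣p∣≡p (<⇒≤ 0<q)) ⟨
    ∣ p - τ ∣ * ∣ α + β ∣
      ≡⟨ ∣p*q∣≡∣p∣*∣q∣ (p - τ) (α + β) ⟨
    ∣ (p - τ) * (α + β) ∣
      ≡⟨ cong ∣_∣ (modulo 1ℚ pq≡ (solve 6 (λ p s s′ τ α β →
           (p :- τ) :* (α :+ β) := α :* (s :- τ) :+ β :* (s′ :- τ)
             :+ con 1ℚ :* (p :* (α :+ β) :- (α :* s :+ β :* s′))) refl p s s′ τ α β)) ⟩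
    ∣ α * (s - τ) + β * (s′ - τ) ∣
      ≤⟨ ∣p+q∣≤∣p∣+∣q∣ (α * (s - τ)) (β * (s′ - τ)) ⟩
    ∣ α * (s - τ) ∣ + ∣ β * (s′ - τ) ∣
      ≤⟨ +-mono-≤ (scale 0≤α s≈τ) (scale 0≤β s′≈τ) ⟩
    α * δ + β * δ
      ≡⟨ solve 3 (λ α β δ → α :* δ :+ β :* δ := δ :* (α :+ β)) refl α β δ ⟩
    δ * (α + β) ∎)
  where
    open ≤-Reasoning
    scale : ∀ {α r} → 0ℚ ≤ α → ∣ r ∣ ≤ δ → ∣ α * r ∣ ≤ α * δ
    scale {α} {r} 0≤α r≤δ = begin
      ∣ α * r ∣       ≡⟨ ∣p*q∣≡∣p∣*∣q∣ α r ⟩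
      ∣ α ∣ * ∣ r ∣   ≡⟨ cong (_* ∣ r ∣) (0≤p⇒∣p∣≡p 0≤α) ⟩
      α * ∣ r ∣       ≤⟨ *-monoˡ-≤-nonNeg α {{nonNegative 0≤α}} r≤δ ⟩
      α * δ           ∎

-- Natural numbers among the rationals

-- `+ n / 1` is normalised by a gcd that does not compute for a variable `n`; the explicit form lets
-- sums and comparisons unfold.
fromℕ≡mkℚ : ∀ n → fromℕ n ≡ mkℚ (+ n) 0 (Coprime.sym (Coprime.1-coprimeTo n))
fromℕ≡mkℚ n = normalize-coprime (Coprime.sym (Coprime.1-coprimeTo n))

fromℕ-suc : ∀ n → fromℕ (suc n) ≡ 1ℚ + fromℕ n
fromℕ-suc n = trans
  (cong (λ i → (+ 1 ℤ.+ i) / 1) (sym (ℤ.*-identityʳ (+ n))))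
  (cong (λ q → 1ℚ + q) (sym (fromℕ≡mkℚ n)))

fromℕ-+ : ∀ m n → fromℕ (m ℕ.+ n) ≡ fromℕ m + fromℕ n
fromℕ-+ zero    n = sym (+-identityˡ (fromℕ n))
fromℕ-+ (suc m) n = begin
  fromℕ (suc (m ℕ.+ n))      ≡⟨ fromℕ-suc (m ℕ.+ n) ⟩
  1ℚ + fromℕ (m ℕ.+ n)       ≡⟨ cong (λ q → 1ℚ + q) (fromℕ-+ m n) ⟩
  1ℚ + (fromℕ m + fromℕ n)   ≡⟨ +-assoc 1ℚ (fromℕ m) (fromℕ n) ⟨
  1ℚ + fromℕ m + fromℕ n     ≡⟨ cong (_+ fromℕ n) (fromℕ-suc m) ⟨
  fromℕ (suc m) + fromℕ n    ∎
  where open ≡-Reasoning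

fromℕ-nonneg : ∀ n → 0ℚ ≤ fromℕ n
fromℕ-nonneg zero    = ≤-refl
fromℕ-nonneg (suc n) =
  subst (0ℚ ≤_) (sym (fromℕ-suc n)) (0≤+ 0≤1 (fromℕ-nonneg n))

1≤fromℕ : ∀ {n} → 0 ℕ.< n → 1ℚ ≤ fromℕ n
1≤fromℕ {suc n} _ = ≤-by (fromℕ n) (fromℕ-nonneg n) (fromℕ-suc n)

fromℕ-mono : ∀ {m n} → m ℕ.≤ n → fromℕ m ≤ fromℕ n
fromℕ-mono {n = n} ℕ.z≤n = fromℕ-nonneg n
fromℕ-mono {suc m} {suc n} (ℕ.s≤s m≤n) = subst₂ _≤_
  (sym (fromℕ-suc m)) (sym (fromℕ-suc n)) (+-monoʳ-≤ 1ℚ (fromℕ-mono m≤n))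

-- A non-negative fraction is at most its numerator, since its denominator is at least 1.
archimedean : ∀ p → ∃[ n ] p ≤ fromℕ n
archimedean p@(mkℚ (+ n) d _) = n , subst (p ≤_) (sym (fromℕ≡mkℚ n))
  (*≤* (ℤ.*-monoˡ-≤-nonNeg (+ n) (+≤+ (ℕ.s≤s ℕ.z≤n))))
archimedean p@(mkℚ -[1+ n ] d _) = 0 , <⇒≤ (negative⁻¹ p)

-- Cauchy sequences

CauchySeq : (ℕ → ℚ) → Set
CauchySeq s = ∀ ε → 0ℚ < ε →
  ∃[ N ] (∀ m n → N ℕ.≤ m → N ℕ.≤ n → ∣ s m - s n ∣ < ε)

limit : ∀ s → CauchySeq s → ℝ
limit s cauchy = record { approx = s ; cauchy = cauchy }

⟶-limit : ∀ s (cauchy : CauchySeq s) → s ⟶ limit s cauchy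
⟶-limit s cauchy ε 0<ε with <-dense 0<ε
... | δ , 0<δ , δ<ε with cauchy δ 0<δ
... | N , close = N , λ n N≤n → δ , δ<ε , N , λ j N≤j → <⇒≤ (close n j N≤n N≤j)

-- Weighted means of consecutive terms

-- The quotient of `p` by `q` is the mean, but numerator and denominator stay separate to match `P`
-- and `Q`. Strictness of `0<β` makes the denominator positive.
record WeightedMean (s : ℕ → ℚ) (N : ℕ) (p q : ℚ) : Set where
  field
    i   : ℕ
    α β : ℚ
    N≤i : N ℕ.≤ i
    0≤α : 0ℚ ≤ α
    0<β : 0ℚ < β
    p≡  : p ≡ α * s i + β * s (suc i)
    q≡  : q ≡ α + β

  q>0 : 0ℚ < q
  q>0 = subst (0ℚ <_) (sym q≡) (+-mono-≤-< 0≤α 0<β)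

weightedMean-≤ : ∀ {s M N p q} → M ℕ.≤ N → WeightedMean s N p q → WeightedMean s M p q
weightedMean-≤ M≤N W = record
  { i = i ; α = α ; β = β ; N≤i = ℕ.≤-trans M≤N N≤i
  ; 0≤α = 0≤α ; 0<β = 0<β ; p≡ = p≡ ; q≡ = q≡ }
  where open WeightedMean W

-- Past the Cauchy index for `δ`, both averaged terms lie within `δ` of every later `s j`, hence so
-- does their mean.
weightedMeans-⟶ : (s p q : ℕ → ℚ) (K : ℕ → ℕ) →
  (∀ N m → K N ℕ.≤ m → WeightedMean s N (p m) (q m)) →
  (cauchy : CauchySeq s) → (λ m → p m ⊘ q m) ⟶ limit s cauchy
weightedMeans-⟶ s p q K means cauchy ε 0<ε with <-dense 0<ε
... | δ , 0<δ , δ<ε with cauchy δ 0<δ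
... | N , close = K N , λ m K≤m → near m (means N m K≤m)
  where
    near : ∀ m → WeightedMean s N (p m) (q m) → ∣ p m ⊘ q m - limit s cauchy ∣< ε
    near m M = δ , δ<ε , N , λ j N≤j →
      weighted-mean-close {p m ⊘ q m} q>0 0≤α (<⇒≤ 0<β)
        (<⇒≤ (close i j N≤i N≤j)) (<⇒≤ (close (suc i) j (ℕ.m≤n⇒m≤1+n N≤i) N≤j))
        (trans (⊘-* (0<⇒≢0 q>0)) p≡) q≡
      where open WeightedMean M

-- A Cauchy criterion for increments that halve

module _ (s t : ℕ → ℚ) (n₀ : ℕ)
         (t≥0 : ∀ n → 0ℚ ≤ t n)
         (step : ∀ n → ∣ s (suc n) - s n ∣ ≤ t n)
         (halving : ∀ n → n₀ ℕ.≤ n → t (suc n) + t (suc n) ≤ t n) where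

  private
    -- Telescoping: t n ≤ 2 t n − 2 t (n + 1).
    tail : ∀ j n → n₀ ℕ.≤ n →
           ∣ s (j ℕ.+ n) - s n ∣ ≤ (t n + t n) - (t (j ℕ.+ n) + t (j ℕ.+ n))
    tail zero n n₀≤n = ≤-reflexive (trans (cong ∣_∣ (+-inverseʳ (s n)))
                                          (sym (+-inverseʳ (t n + t n))))
    tail (suc j) n n₀≤n = begin
      ∣ s (suc m) - s n ∣
        ≤⟨ ∣-∣-triangle (s (suc m)) (s m) (s n) ⟩
      ∣ s (suc m) - s m ∣ + ∣ s m - s n ∣
        ≤⟨ +-mono-≤ (step m) (tail j n n₀≤n) ⟩
      t m + ((t n + t n) - (t m + t m))
        ≤⟨ ≤-by _ (0≤- (halving m (ℕ.≤-trans n₀≤n (ℕ.m≤n+m n j))))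
             (solve 3 (λ u v w → (w :+ w) :- (v :+ v) :=
                (u :+ ((w :+ w) :- (u :+ u))) :+ (u :- (v :+ v))) refl (t m) (t (suc m)) (t n)) ⟩
      (t n + t n) - (t (suc m) + t (suc m)) ∎
      where
        open ≤-Reasoning
        m = j ℕ.+ n

    tail-bound : ∀ m n → n₀ ℕ.≤ n → n ℕ.≤ m → ∣ s m - s n ∣ ≤ t n + t n
    tail-bound m n n₀≤n n≤m = ≤-trans
      (subst (λ k → ∣ s k - s n ∣ ≤ (t n + t n) - (t k + t k)) (ℕ.m∸n+n≡m n≤m)
        (tail (m ℕ.∸ n) n n₀≤n))
      (≤-by _ (0≤+ (t≥0 m) (t≥0 m))
        (solve 2 (λ u v → u := (u :- v) :+ v) refl (t n + t n) (t m + t m)))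

    -- `(2 + j) v ≤ 2 (1 + j) v ≤ (1 + j) u`.
    decay-step : ∀ {j u v} → 0ℚ ≤ j → 0ℚ ≤ v → v + v ≤ u →
                 (1ℚ + (1ℚ + j)) * v ≤ (1ℚ + j) * u
    decay-step {j} {u} {v} 0≤j 0≤v 2v≤u =
      ≤-by _ (0≤+ (0≤* (0≤+ 0≤1 0≤j) (0≤- 2v≤u)) (0≤* 0≤j 0≤v))
        (solve 3 (λ j u v → (con 1ℚ :+ j) :* u :=
          (con 1ℚ :+ (con 1ℚ :+ j)) :* v
            :+ ((con 1ℚ :+ j) :* (u :- (v :+ v)) :+ j :* v)) refl j u v)

    -- This rate is weaker than the geometric one, but it suffices and lets the Archimedean property
    -- supply the index without powers of two.
    decay : ∀ j → (1ℚ + fromℕ j) * t (j ℕ.+ n₀) ≤ t n₀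
    decay zero = ≤-reflexive (*-identityˡ (t n₀))
    decay (suc j) = ≤-trans
      (subst (λ k → (1ℚ + k) * t (suc m) ≤ (1ℚ + fromℕ j) * t m) (sym (fromℕ-suc j))
        (decay-step (fromℕ-nonneg j) (t≥0 (suc m)) (halving m (ℕ.m≤n+m n₀ j))))
      (decay j)
      where m = j ℕ.+ n₀

  halving⇒cauchy : CauchySeq s
  halving⇒cauchy ε 0<ε = N , close
    where
      4t₀ = (t n₀ + t n₀) + (t n₀ + t n₀)
      -- `J` is at least `4t₀ / ε`. The extra 1 in `1ℚ + fromℕ J` makes the later bound strict. The
      -- factor 4 comes from two tails, each at most `t N + t N`.
      J = proj₁ (archimedean (4t₀ ⊘ ε))
      N = J ℕ.+ n₀
      4t = (t N + t N) + (t N + t N)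

      4t₀<Jε : 4t₀ < (1ℚ + fromℕ J) * ε
      4t₀<Jε = begin-strict
        4t₀                   ≡⟨ ⊘-* (0<⇒≢0 0<ε) ⟨
        4t₀ ⊘ ε * ε           ≤⟨ *-monoʳ-≤-nonNeg ε {{nonNegative (<⇒≤ 0<ε)}}
                                   (proj₂ (archimedean (4t₀ ⊘ ε))) ⟩
        fromℕ J * ε           ≡⟨ +-identityˡ _ ⟨
        0ℚ + fromℕ J * ε      <⟨ +-monoˡ-< (fromℕ J * ε) 0<ε ⟩
        ε + fromℕ J * ε       ≡⟨ solve 2 (λ ε j → ε :+ j :* ε := (con 1ℚ :+ j) :* ε)
                                   refl ε (fromℕ J) ⟩
        (1ℚ + fromℕ J) * ε    ∎
        where open ≤-Reasoning

      4t<ε : 4t < ε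
      4t<ε = *-cancelˡ-<-nonNeg (1ℚ + fromℕ J)
        {{nonNegative (0≤+ 0≤1 (fromℕ-nonneg J))}} (begin-strict
          (1ℚ + fromℕ J) * 4t
            ≡⟨ solve 2 (λ j t → j :* ((t :+ t) :+ (t :+ t)) :=
                 (j :* t :+ j :* t) :+ (j :* t :+ j :* t)) refl (1ℚ + fromℕ J) (t N) ⟩
          _ ≤⟨ +-mono-≤ (+-mono-≤ (decay J) (decay J)) (+-mono-≤ (decay J) (decay J)) ⟩
          4t₀ <⟨ 4t₀<Jε ⟩
          (1ℚ + fromℕ J) * ε ∎)
        where open ≤-Reasoning

      close : ∀ m n → N ℕ.≤ m → N ℕ.≤ n → ∣ s m - s n ∣ < ε
      close m n N≤m N≤n = begin-strict
        ∣ s m - s n ∣                    ≤⟨ ∣-∣-triangle (s m) (s N) (s n) ⟩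
        ∣ s m - s N ∣ + ∣ s N - s n ∣    ≡⟨ cong (λ q → ∣ s m - s N ∣ + q) (∣p-q∣≡∣q-p∣ (s N) (s n)) ⟩
        ∣ s m - s N ∣ + ∣ s n - s N ∣    ≤⟨ +-mono-≤ (tail-bound m N n₀≤N N≤m) (tail-bound n N n₀≤N N≤n) ⟩
        4t                               <⟨ 4t<ε ⟩
        ε                                ∎
        where
          open ≤-Reasoning
          n₀≤N = ℕ.m≤n+m n₀ J

-- Polynomials

eval₁-nonneg : ∀ p {y} → 0ℚ ≤ y → 0ℚ ≤ eval₁ p y
eval₁-nonneg []       0≤y = ≤-refl
eval₁-nonneg (c ∷ cs) 0≤y = 0≤+ (fromℕ-nonneg c) (0≤* 0≤y (eval₁-nonneg cs 0≤y))

eval₂-nonneg : ∀ p {x y} → 0ℚ ≤ x → 0ℚ ≤ y → 0ℚ ≤ eval₂ p x y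
eval₂-nonneg []       0≤x 0≤y = ≤-refl
eval₂-nonneg (p ∷ ps) 0≤x 0≤y =
  0≤+ (eval₁-nonneg p 0≤y) (0≤* 0≤x (eval₂-nonneg ps 0≤x 0≤y))

≤-+ˡ : ∀ {p q r} → 0ℚ ≤ q → p ≤ r → p ≤ q + r
≤-+ˡ {p} {q} {r} 0≤q p≤r = subst (_≤ q + r) (+-identityˡ p) (+-mono-≤ 0≤q p≤r)

≤-+ʳ : ∀ {p q r} → 0ℚ ≤ r → p ≤ q → p ≤ q + r
≤-+ʳ {p} {q} {r} 0≤r p≤q = subst (_≤ q + r) (+-identityʳ p) (+-mono-≤ p≤q 0≤r)

≤-*ʳ : ∀ {p q r} → 0ℚ ≤ q → 1ℚ ≤ r → p ≤ q → p ≤ q * r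
≤-*ʳ {p} {q} {r} 0≤q 1≤r p≤q = ≤-trans p≤q
  (subst (_≤ q * r) (*-identityʳ q) (*-monoˡ-≤-nonNeg q {{nonNegative 0≤q}} 1≤r))

-- One positive coefficient contributes at least 1, because powers of `y` are at least 1 and all
-- other terms are non-negative.
eval₁≥1 : ∀ {p y} → Any (_≢ 0) p → 1ℚ ≤ y → 1ℚ ≤ eval₁ p y
eval₁≥1 {c ∷ cs} (here c≢0) 1≤y =
  ≤-+ʳ (0≤* 0≤y (eval₁-nonneg cs 0≤y)) (1≤fromℕ (ℕ.n≢0⇒n>0 c≢0))
  where 0≤y = ≤-trans 0≤1 1≤y
eval₁≥1 {c ∷ cs} (there nz) 1≤y =
  ≤-+ˡ (fromℕ-nonneg c) (≤-*ʳ (≤-trans 0≤1 1≤y) (eval₁≥1 nz 1≤y) 1≤y)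

eval₂≥1 : ∀ {p x y} → NonzeroPoly p → 1ℚ ≤ x → 1ℚ ≤ y → 1ℚ ≤ eval₂ p x y
eval₂≥1 {p ∷ ps} (here nz) 1≤x 1≤y =
  ≤-+ʳ (0≤* 0≤x (eval₂-nonneg ps 0≤x (≤-trans 0≤1 1≤y))) (eval₁≥1 nz 1≤y)
  where 0≤x = ≤-trans 0≤1 1≤x
eval₂≥1 {p ∷ ps} (there nz) 1≤x 1≤y =
  ≤-+ˡ (eval₁-nonneg p (≤-trans 0≤1 1≤y))
    (≤-*ʳ (≤-trans 0≤1 1≤x) (eval₂≥1 nz 1≤x 1≤y) 1≤x)

eval₂-00 : ∀ c cs ps → eval₂ ((c ∷ cs) ∷ ps) 0ℚ 0ℚ ≡ fromℕ c
eval₂-00 c cs ps = solve 3 (λ c u v → (c :+ con 0ℚ :* u) :+ con 0ℚ :* v := c) refl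
  (fromℕ c) (eval₁ cs 0ℚ) (eval₂ ps 0ℚ 0ℚ)

-- Without constant term, some monomial of positive degree occurs.
eval₂≥x : ∀ {p x y} → NonzeroPoly p → eval₂ p 0ℚ 0ℚ ≡ 0ℚ →
          1ℚ ≤ x → x ≤ y → x ≤ eval₂ p x y
eval₂≥x {(c ∷ cs) ∷ ps} (here (here c≢0)) p₀ _ _ = contradiction
  (trans (sym (eval₂-00 c cs ps)) p₀)
  (0<⇒≢0 (<-≤-trans 0<1 (1≤fromℕ (ℕ.n≢0⇒n>0 c≢0))))
eval₂≥x {(c ∷ cs) ∷ ps} (here (there nz)) _ 1≤x x≤y =
  ≤-+ʳ (0≤* 0≤x (eval₂-nonneg ps 0≤x 0≤y))
    (≤-+ˡ (fromℕ-nonneg c) (≤-*ʳ 0≤y (eval₁≥1 nz (≤-trans 1≤x x≤y)) x≤y))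
  where
    0≤x = ≤-trans 0≤1 1≤x
    0≤y = ≤-trans 0≤x x≤y
eval₂≥x {p ∷ ps} (there nz) _ 1≤x x≤y =
  ≤-+ˡ (eval₁-nonneg p (≤-trans 0≤x x≤y))
    (≤-*ʳ 0≤x (eval₂≥1 nz 1≤x (≤-trans 1≤x x≤y)) ≤-refl)
  where 0≤x = ≤-trans 0≤1 1≤x

-- The sequence x

-- The new ratio `x″ / x′` equals `(x′ / x) (f + 1)`, which is at least `2 N` and hence at least
-- `1 + N`.
growth-step : ∀ {x x′ x″ f N} → 1ℚ ≤ x → 0ℚ ≤ x′ → 1ℚ ≤ N → N * x ≤ x′ → 1ℚ ≤ f →
              x″ * x ≡ x′ ^ 2 * (f + 1ℚ) → (1ℚ + N) * x′ ≤ x″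
growth-step {x} {x′} {x″} {f} {N} 1≤x 0≤x′ 1≤N Nx≤x′ 1≤f eq =
  *-cancelʳ-≤-pos x {{positive (<-≤-trans 0<1 1≤x)}}
    -- The difference of the two sides, multiplied by `x`, splits into three terms that measure the
    -- slack in `Nx≤x′`, `1≤f` and `1≤N`.
    (≤-by (x′ * ((x′ - N * x) * (f + 1ℚ) + N * x * (f - 1ℚ) + (N - 1ℚ) * x))
      (0≤* 0≤x′ (0≤+ (0≤+ (0≤* (0≤- Nx≤x′) (0≤+ (≤-trans 0≤1 1≤f) 0≤1))
                          (0≤* (0≤* (≤-trans 0≤1 1≤N) 0≤x) (0≤- 1≤f)))
                     (0≤* (0≤- 1≤N) 0≤x)))
      (trans eq (solve 4 (λ x x′ f N →
        x′ :* (x′ :* con 1ℚ) :* (f :+ con 1ℚ) :=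
        (con 1ℚ :+ N) :* x′ :* x :+
          x′ :* ((x′ :- N :* x) :* (f :+ con 1ℚ) :+ N :* x :* (f :- con 1ℚ)
                  :+ (N :- con 1ℚ) :* x))
        refl x x′ f N)))
  where 0≤x = ≤-trans 0≤1 1≤x

-- One period of the continued fraction (three steps), in terms of the
-- scale c = cₖ, q = hᵏ and the values s′, s, s″ = s k, s (k + 1), s (k + 2).
period₁ : ∀ {c H g y x x′ f y′ s s′ s″} → y * x ≡ x′ → g * x ≡ f → y′ ≡ y * (f + 1ℚ) →
          (s″ - s) * y′ + H * (s - s′) ≡ 0ℚ →
          (g - 1ℚ) * (c * x′ * s) + c * (y * s + H * s′) + c * x′ * s ≡ c * (y′ * s″ + H * s)
period₁ {c} {H} {g} {y} {x} {s = s} {s′} {s″} refl refl refl rel = modulo (- c) rel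
  (solve 8 (λ c H g y x s s′ s″ →
    let y′ = y :* (g :* x :+ con 1ℚ) in
    (g :- con 1ℚ) :* (c :* (y :* x) :* s) :+ c :* (y :* s :+ H :* s′) :+ c :* (y :* x) :* s :=
    c :* (y′ :* s″ :+ H :* s) :+ (:- c) :* ((s″ :- s) :* y′ :+ H :* (s :- s′) :- con 0ℚ))
    refl c H g y x s s′ s″)

period₂ : ∀ {c H q x′ x″ y′ s s″ w w′} → y′ * x′ ≡ x″ → w′ ≡ w + c * x′ * s →
          w′ ≡ c * (y′ * s″ + H * s) →
          (q * (x′ - H)) * w′ + (H * q) * w ≡ q * c * x″ * s″
period₂ {c} {H} {q} {x′} {y′ = y′} {s} {s″} {w} refl refl eq = modulo (q * x′) eq
  (solve 8 (λ c H q x′ y′ s s″ w →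
    q :* (x′ :- H) :* (w :+ c :* x′ :* s) :+ H :* q :* w :=
    q :* c :* (y′ :* x′) :* s″
      :+ q :* x′ :* ((w :+ c :* x′ :* s) :- c :* (y′ :* s″ :+ H :* s)))
    refl c H q x′ y′ s s″ w)

module _ {F : ℕ → Poly₂} (F≢0 : ∀ n → NonzeroPoly (F n))
         (F₀₀ : ∀ n → eval₂ (F n) 0ℚ 0ℚ ≡ 0ℚ)
         {x : ℕ → ℚ} (R : IsRecurrence F x) where

  open IsRecurrence R

  f : ℕ → ℚ
  f n = eval₂ (F n) (x n) (x (suc n))

  growth⇒mono : ∀ n → 1ℚ ≤ x n → fromℕ (suc n) * x n ≤ x (suc n) → x n ≤ x (suc n)
  growth⇒mono n 1≤x grow = ≤-trans
    (subst (_≤ fromℕ (suc n) * x n) (*-identityˡ (x n))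
      (*-monoʳ-≤-nonNeg (x n) {{nonNegative (≤-trans 0≤1 1≤x)}} (1≤fromℕ {suc n} (ℕ.s≤s ℕ.z≤n))))
    grow

  -- The bounds need each other: growth at `n` keeps the next term at least 1, and terms at least 1
  -- make the value of `F n` at least 1, which drives the next growth.
  growth : ∀ n → 1ℚ ≤ x n × fromℕ (suc n) * x n ≤ x (suc n)
  growth zero with x₁
  ... | m , 0<m , x₁≡m = ≤-reflexive (sym x₀) ,
    subst₂ _≤_ (trans (sym (*-identityˡ 1ℚ)) (cong (1ℚ *_) (sym x₀))) (sym x₁≡m) (1≤fromℕ 0<m)
  growth (suc n) = 1≤x′ ,
    subst (λ N → N * x (suc n) ≤ x (suc (suc n))) (sym (fromℕ-suc (suc n)))
      (growth-step 1≤x (≤-trans 0≤1 1≤x′) (1≤fromℕ {suc n} (ℕ.s≤s ℕ.z≤n)) grow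
        (eval₂≥1 (F≢0 n) 1≤x 1≤x′) (rec n))
    where
      1≤x  = proj₁ (growth n)
      grow = proj₂ (growth n)
      1≤x′ = ≤-trans 1≤x (growth⇒mono n 1≤x grow)

  x≥1 : ∀ n → 1ℚ ≤ x n
  x≥1 n = proj₁ (growth n)

  x>0 : ∀ n → 0ℚ < x n
  x>0 n = <-≤-trans 0<1 (x≥1 n)

  x≤f : ∀ n → x n ≤ f n
  x≤f n = eval₂≥x (F≢0 n) (F₀₀ n) (x≥1 n) (growth⇒mono n (x≥1 n) (proj₂ (growth n)))

  y : ℕ → ℚ
  y n = x (suc n) ⊘ x n

  y*x : ∀ n → y n * x n ≡ x (suc n)
  y*x n = ⊘-* (0<⇒≢0 (x>0 n))

  y-lower : ∀ n → fromℕ (suc n) ≤ y n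
  y-lower n = *-cancelʳ-≤-pos (x n) {{positive (x>0 n)}}
    (≤-trans (proj₂ (growth n)) (≤-reflexive (sym (y*x n))))

  y>0 : ∀ n → 0ℚ < y n
  y>0 n = <-≤-trans 0<1 (≤-trans (1≤fromℕ {suc n} (ℕ.s≤s ℕ.z≤n)) (y-lower n))

  -- The recurrence divided by `x n * x (suc n)`.
  y-suc : ∀ n → y (suc n) ≡ y n * (f n + 1ℚ)
  y-suc n = *-cancelʳ-≡ (0<* (x>0 (suc n)) (x>0 n))
    (lemma {y = y n} {y (suc n)} {f n} (y*x n) (y*x (suc n)) (rec n))
    where
      lemma : ∀ {x x′ x″ y y′ f} → y * x ≡ x′ → y′ * x′ ≡ x″ →
              x″ * x ≡ x′ ^ 2 * (f + 1ℚ) → y′ * (x′ * x) ≡ y * (f + 1ℚ) * (x′ * x)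
      lemma {x} {x′} {_} {y} {y′} {f} refl refl eq = trans (sym (*-assoc y′ x′ x)) (trans eq
        (solve 3 (λ x y f → y :* x :* (y :* x :* con 1ℚ) :* (f :+ con 1ℚ) :=
                            y :* (f :+ con 1ℚ) :* (y :* x :* x)) refl x y f))

  g : ℕ → ℚ
  g n = f n ⊘ x n

  g*x : ∀ n → g n * x n ≡ f n
  g*x n = ⊘-* (0<⇒≢0 (x>0 n))

  -- This keeps the partial denominators `b₃ₖ`, equal to `g k - 1`, non-negative, so that they can
  -- enter the weights.
  g≥1 : ∀ n → 1ℚ ≤ g n
  g≥1 n = *-cancelʳ-≤-pos (x n) {{positive (x>0 n)}}
    (subst₂ _≤_ (sym (*-identityˡ (x n))) (sym (g*x n)) (x≤f n))

  -- Terms and partial sums of the series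

  module _ {h : ℕ} (0<h : 0 ℕ.< h) where

    private
      H : ℚ
      H = fromℕ h

      H>0 : 0ℚ < H
      H>0 = <-≤-trans 0<1 (1≤fromℕ 0<h)

    t u S : ℕ → ℚ
    t n = H ^ n ⊘ x (suc n)
    u n = (- 1ℚ) ^ n * t n
    S = partialSum u

    t*x : ∀ n → t n * x (suc n) ≡ H ^ n
    t*x n = ⊘-* (0<⇒≢0 (x>0 (suc n)))

    t>0 : ∀ n → 0ℚ < t n
    t>0 n = *-cancelʳ-<-nonNeg (x (suc n)) {{nonNegative (<⇒≤ (x>0 (suc n)))}}
      (subst₂ _<_ (sym (*-zeroˡ (x (suc n)))) (sym (t*x n)) (^-pos H>0 n))

    t-suc : ∀ n → t (suc n) * y (suc n) ≡ H * t n
    t-suc n = *-cancelʳ-≡ (x>0 (suc n)) (begin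
      t (suc n) * y (suc n) * x (suc n)   ≡⟨ *-assoc (t (suc n)) (y (suc n)) (x (suc n)) ⟩
      t (suc n) * (y (suc n) * x (suc n)) ≡⟨ cong (t (suc n) *_) (y*x (suc n)) ⟩
      t (suc n) * x (suc (suc n))         ≡⟨ t*x (suc n) ⟩
      H * H ^ n                           ≡⟨ cong (H *_) (t*x n) ⟨
      H * (t n * x (suc n))               ≡⟨ *-assoc H (t n) (x (suc n)) ⟨
      H * t n * x (suc n)                 ∎)
      where open ≡-Reasoning

    -- The two differences are consecutive terms of opposite sign, so this is `t-suc` up to the
    -- factor `(- 1ℚ) ^ n`.
    S-rel : ∀ n → (S (2 ℕ.+ n) - S (1 ℕ.+ n)) * y (1 ℕ.+ n) + H * (S (1 ℕ.+ n) - S n) ≡ 0ℚ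
    S-rel n = lemma (S n) ((- 1ℚ) ^ n) (t n) (t (suc n)) (y (suc n)) H (t-suc n)
      where
        lemma : ∀ S e t t′ y H → t′ * y ≡ H * t →
                ((S + e * t + - 1ℚ * e * t′) - (S + e * t)) * y + H * ((S + e * t) - S) ≡ 0ℚ
        lemma S e t t′ y H eq = modulo (- e) eq
          (solve 6 (λ S e t t′ y H →
             ((S :+ e :* t :+ con (- 1ℚ) :* e :* t′) :- (S :+ e :* t)) :* y
               :+ H :* ((S :+ e :* t) :- S) :=
             con 0ℚ :+ (:- e) :* (t′ :* y :- H :* t)) refl S e t t′ y H)

    S-cauchy : CauchySeq S
    -- From `n = 2h` on, `y (suc n) ≥ n + 2 ≥ 2h`, so the ratio `H / y (suc n)` of consecutive `t`
    -- is at most one half.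
    S-cauchy = halving⇒cauchy S t (h ℕ.+ h) (λ n → <⇒≤ (t>0 n)) step halving
      where
        step : ∀ n → ∣ S (suc n) - S n ∣ ≤ t n
        step n = ≤-reflexive (begin
          ∣ S n + u n - S n ∣            ≡⟨ cong ∣_∣ (solve 2 (λ S u → S :+ u :- S := u) refl (S n) (u n)) ⟩
          ∣ (- 1ℚ) ^ n * t n ∣           ≡⟨ ∣p*q∣≡∣p∣*∣q∣ ((- 1ℚ) ^ n) (t n) ⟩
          ∣ (- 1ℚ) ^ n ∣ * ∣ t n ∣       ≡⟨ cong (_* ∣ t n ∣) (∣-1^n∣≡1 n) ⟩
          1ℚ * ∣ t n ∣                   ≡⟨ *-identityˡ ∣ t n ∣ ⟩
          ∣ t n ∣                        ≡⟨ 0≤p⇒∣p∣≡p (<⇒≤ (t>0 n)) ⟩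
          t n                            ∎)
          where open ≡-Reasoning

        halving : ∀ n → h ℕ.+ h ℕ.≤ n → t (suc n) + t (suc n) ≤ t n
        halving n 2h≤n = *-cancelˡ-≤-pos H {{positive H>0}} (begin
          H * (t (suc n) + t (suc n))
            ≡⟨ solve 2 (λ H t → H :* (t :+ t) := t :* (H :+ H)) refl H (t (suc n)) ⟩
          t (suc n) * (H + H)
            ≤⟨ *-monoˡ-≤-nonNeg (t (suc n)) {{nonNegative (<⇒≤ (t>0 (suc n)))}} 2H≤y ⟩
          t (suc n) * y (suc n)
            ≡⟨ t-suc n ⟩
          H * t n ∎)
          where
            open ≤-Reasoning
            2H≤y : H + H ≤ y (suc n)
            2H≤y = begin
              H + H                ≡⟨ fromℕ-+ h h ⟨
              fromℕ (h ℕ.+ h)      ≤⟨ fromℕ-mono (ℕ.m≤n⇒m≤1+n (ℕ.m≤n⇒m≤1+n 2h≤n)) ⟩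
              fromℕ (2 ℕ.+ n)      ≤⟨ y-lower (suc n) ⟩
              y (suc n)            ∎

    -- Closed forms of numerators and denominators

    module _ {a b : ℕ → ℚ} (E : IsExpansion F x h a b) where

      open IsExpansion E hiding (H)

      -- Exactly what the closed forms use of the numerators with `s = S` and of the denominators
      -- with `s = 1`, so that one induction serves both.
      record Solution (W s : ℕ → ℚ) : Set where
        field
          init₁ : W 1 ≡ x 1 * s 1
          init₂ : W 2 ≡ x 2 * s 2
          step  : ∀ k → W (2 ℕ.+ k) ≡ b (2 ℕ.+ k) * W (1 ℕ.+ k) + a (2 ℕ.+ k) * W k
          rel   : ∀ k → (s (2 ℕ.+ k) - s (1 ℕ.+ k)) * y (1 ℕ.+ k) + H * (s (1 ℕ.+ k) - s k) ≡ 0ℚ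

      -- c j is the scale cₖ for k = j + 1.
      c : ℕ → ℚ
      c zero    = x 1
      c (suc j) = H ^ suc j * c j

      c>0 : ∀ j → 0ℚ < c j
      c>0 zero    = x>0 1
      c>0 (suc j) = 0<* (^-pos H>0 (suc j)) (c>0 j)

      2≤ : ∀ j → 2 ℕ.≤ 2 ℕ.+ j
      2≤ = ℕ.m≤m+n 2

      -- Here and below, the coefficients for `k = j + 2` are reindexed to the shape `i + j * 3`,
      -- which computes when `j` becomes `suc j`.
      a₅₊ : ∀ j → a (5 ℕ.+ j ℕ.* 3) ≡ H ^ (2 ℕ.+ j)
      a₅₊ j = trans (cong (λ i → a (i ℕ.∸ 1)) (ℕ.*-comm (2 ℕ.+ j) 3)) (a₃ₖ₋₁ (2 ℕ.+ j) (2≤ j))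

      b₅₊ : ∀ j → b (5 ℕ.+ j ℕ.* 3) ≡ H ^ (1 ℕ.+ j) * (x (2 ℕ.+ j) - H)
      b₅₊ j = trans (cong (λ i → b (i ℕ.∸ 1)) (ℕ.*-comm (2 ℕ.+ j) 3)) (b₃ₖ₋₁ (2 ℕ.+ j) (2≤ j))

      a₆₊ : ∀ j → a (6 ℕ.+ j ℕ.* 3) ≡ H ^ (1 ℕ.+ j)
      a₆₊ j = trans (cong a (ℕ.*-comm (2 ℕ.+ j) 3)) (a₃ₖ (2 ℕ.+ j) (2≤ j))

      b₆₊ : ∀ j → b (6 ℕ.+ j ℕ.* 3) ≡ g (2 ℕ.+ j) - 1ℚ
      b₆₊ j = trans (cong b (ℕ.*-comm (2 ℕ.+ j) 3)) (b₃ₖ (2 ℕ.+ j) (2≤ j))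

      7+≡ : ∀ j → 7 ℕ.+ j ℕ.* 3 ≡ 3 ℕ.* (2 ℕ.+ j) ℕ.+ 1
      7+≡ j = trans (ℕ.+-comm 1 (6 ℕ.+ j ℕ.* 3)) (cong (ℕ._+ 1) (ℕ.*-comm (2 ℕ.+ j) 3))

      a₇₊ : ∀ j → a (7 ℕ.+ j ℕ.* 3) ≡ 1ℚ
      a₇₊ j = trans (cong a (7+≡ j)) (a₃ₖ₊₁ (2 ℕ.+ j) (2≤ j))

      b₇₊ : ∀ j → b (7 ℕ.+ j ℕ.* 3) ≡ 1ℚ
      b₇₊ j = trans (cong b (7+≡ j)) (b₃ₖ₊₁ (2 ℕ.+ j) (2≤ j))

      module _ {W s : ℕ → ℚ} (sol : Solution W s) where

        open Solution sol

        step-by : ∀ k {p q} → b (2 ℕ.+ k) ≡ p → a (2 ℕ.+ k) ≡ q →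
                  W (2 ℕ.+ k) ≡ p * W (1 ℕ.+ k) + q * W k
        step-by k refl refl = step k

        -- With `k = j + 1`, the closed forms concern the indices `3k`, `3k + 1` and `3k + 2`.
        -- `Penultimate` is the recurrence at `3k + 1` after its last term has been evaluated; for
        -- `k = 1` the coefficient `a 4 ≡ x 1` provides the scale `c 0`.
        Closed₀ Closed₁ Closed₂ Penultimate : ℕ → Set
        Closed₀ j = W (3 ℕ.+ j ℕ.* 3) ≡ (g (1 ℕ.+ j) - 1ℚ) * (c j * x (2 ℕ.+ j) * s (2 ℕ.+ j))
          + c j * (y (1 ℕ.+ j) * s (2 ℕ.+ j) + H * s (1 ℕ.+ j))
        Closed₁ j = W (4 ℕ.+ j ℕ.* 3) ≡ c j * (y (2 ℕ.+ j) * s (3 ℕ.+ j) + H * s (2 ℕ.+ j))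
        Closed₂ j = W (5 ℕ.+ j ℕ.* 3) ≡ c (1 ℕ.+ j) * x (3 ℕ.+ j) * s (3 ℕ.+ j)
        Penultimate j = W (4 ℕ.+ j ℕ.* 3) ≡
          W (3 ℕ.+ j ℕ.* 3) + c j * x (2 ℕ.+ j) * s (2 ℕ.+ j)

        -- The coefficients at `3k` and `3k + 1` are irregular for `k = 1`; once `Closed₀` and
        -- `Penultimate` are known, all periods proceed alike.
        finish : ∀ j → Closed₀ j → Penultimate j → Closed₀ j × Closed₁ j × Closed₂ j
        finish j w₃ w₄ = w₃ , w₄′ ,
          trans (step-by (3 ℕ.+ j ℕ.* 3) (b₅₊ j) (a₅₊ j))
            (period₂ {c j} {H} {H ^ (1 ℕ.+ j)} {y′ = y (2 ℕ.+ j)} (y*x (2 ℕ.+ j)) w₄ w₄′)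
          where
            w₄′ : Closed₁ j
            w₄′ = trans w₄ (trans (cong (_+ c j * x (2 ℕ.+ j) * s (2 ℕ.+ j)) w₃)
              (period₁ {c j} {H} {g (1 ℕ.+ j)} {y (1 ℕ.+ j)} (y*x (1 ℕ.+ j)) (g*x (1 ℕ.+ j))
                (y-suc (1 ℕ.+ j)) (rel (1 ℕ.+ j))))

        closed : ∀ j → Closed₀ j × Closed₁ j × Closed₂ j
        closed zero = finish zero
          (trans (step-by 1 b₃ a₃) (first {H = H} {y₁ = y 1} {g 1} init₁ init₂ (y*x 1) (g*x 1)))
          (trans (step-by 2 b₄ a₄)
            (cong₂ _+_ (*-identityˡ (W 3))
              (trans (cong (x 1 *_) init₂) (sym (*-assoc (x 1) (x 2) (s 2))))))
          where
            -- The irregular start fits the pattern of later periods, with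
            -- x₁ W₂ and W₂ + h W₁ in place of W₃ₖ₋₁ and hᵏ⁻¹ W₃ₖ₋₂.
            first : ∀ {w₁ w₂ H x₁ x₂ s₁ s₂ y₁ g₁ f₁} →
              w₁ ≡ x₁ * s₁ → w₂ ≡ x₂ * s₂ → y₁ * x₁ ≡ x₂ → g₁ * x₁ ≡ f₁ →
              (f₁ + 1ℚ - x₁) * w₂ + H * w₁ ≡
              (g₁ - 1ℚ) * (x₁ * x₂ * s₂) + x₁ * (y₁ * s₂ + H * s₁)
            first {H = H} {x₁} {s₁ = s₁} {s₂} {y₁} {g₁} refl refl refl refl =
              solve 6 (λ H x₁ s₁ s₂ y₁ g₁ →
                (g₁ :* x₁ :+ con 1ℚ :- x₁) :* (y₁ :* x₁ :* s₂) :+ H :* (x₁ :* s₁) :=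
                (g₁ :- con 1ℚ) :* (x₁ :* (y₁ :* x₁) :* s₂) :+ x₁ :* (y₁ :* s₂ :+ H :* s₁))
                refl H x₁ s₁ s₂ y₁ g₁
        closed (suc j) with closed j
        ... | _ , w₁ , w₂ = finish (suc j)
          (trans (step-by (4 ℕ.+ j ℕ.* 3) (b₆₊ j) (a₆₊ j))
            (cong₂ _+_ (cong ((g (2 ℕ.+ j) - 1ℚ) *_) w₂)
              (trans (cong (H ^ (1 ℕ.+ j) *_) w₁)
                (sym (*-assoc (H ^ (1 ℕ.+ j)) (c j) (y (2 ℕ.+ j) * s (3 ℕ.+ j) + H * s (2 ℕ.+ j)))))))
          (trans (step-by (5 ℕ.+ j ℕ.* 3) (b₇₊ j) (a₇₊ j))
            (cong₂ _+_ (*-identityˡ (W (6 ℕ.+ j ℕ.* 3)))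
              (trans (*-identityˡ (W (5 ℕ.+ j ℕ.* 3))) w₂)))

      -- The initial values match because `S 1 = 1 / x₁` and `S 2 = 1 / x₁ - h / x₂`, while
      -- `P 1 = 1` and `P 2 = x₂ / x₁ - h`.
      P-solution : Solution (P a b) S
      P-solution = record
        { init₁ = trans a₁ (sym (init₁ {x 1} {t 0} (t*x 0)))
        ; init₂ = trans (cong₂ _+_ (cong₂ _*_ b₂ a₁) (*-zeroʳ (a 2)))
                    (sym (init₂ {y₁ = y 1} {t 0} {t 1} {H} (t*x 0) (t*x 1) (y*x 1)))
        ; step  = λ _ → refl
        ; rel   = S-rel
        }
        where
          init₁ : ∀ {x₁ t₀} → t₀ * x₁ ≡ 1ℚ → x₁ * (0ℚ + 1ℚ * t₀) ≡ 1ℚ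
          init₁ {x₁} {t₀} eq = trans
            (solve 2 (λ x t → x :* (con 0ℚ :+ con 1ℚ :* t) := t :* x) refl x₁ t₀) eq

          init₂ : ∀ {x₁ x₂ y₁ t₀ t₁ H} → t₀ * x₁ ≡ 1ℚ → t₁ * x₂ ≡ H * 1ℚ → y₁ * x₁ ≡ x₂ →
                  x₂ * (0ℚ + 1ℚ * t₀ + - 1ℚ * 1ℚ * t₁) ≡ (y₁ - H) * 1ℚ + 0ℚ
          init₂ {x₁} {_} {y₁} {t₀} {t₁} {H} eq₀ eq₁ refl = modulo y₁ eq₀ (modulo (- 1ℚ) eq₁
            (solve 5 (λ x₁ y₁ t₀ t₁ H →
              y₁ :* x₁ :* (con 0ℚ :+ con 1ℚ :* t₀ :+ con (- 1ℚ) :* con 1ℚ :* t₁) :=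
              (y₁ :- H) :* con 1ℚ :+ con 0ℚ :+ y₁ :* (t₀ :* x₁ :- con 1ℚ)
                :+ con (- 1ℚ) :* (t₁ :* (y₁ :* x₁) :- H :* con 1ℚ)) refl x₁ y₁ t₀ t₁ H))

      -- For constant `s` both differences in `rel` vanish, and
      -- `Q 2 = (x₂ / x₁ - h) x₁ + h x₁ = x₂`.
      Q-solution : Solution (Q a b) (λ _ → 1ℚ)
      Q-solution = record
        { init₁ = trans b₁ (sym (*-identityʳ (x 1)))
        ; init₂ = trans (cong₂ _+_ (cong₂ _*_ b₂ b₁) (cong (_* 1ℚ) a₂)) (init₂ {x 1} {y₁ = y 1} {H} (y*x 1))
        ; step  = λ _ → refl
        ; rel   = λ k → solve 2 (λ y H →
            (con 1ℚ :- con 1ℚ) :* y :+ H :* (con 1ℚ :- con 1ℚ) := con 0ℚ) refl (y (suc k)) H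
        }
        where
          init₂ : ∀ {x₁ x₂ y₁ H} → y₁ * x₁ ≡ x₂ → (y₁ - H) * x₁ + H * x₁ * 1ℚ ≡ x₂ * 1ℚ
          init₂ {x₁} {_} {y₁} {H} refl = solve 3 (λ x₁ y₁ H →
            (y₁ :- H) :* x₁ :+ H :* x₁ :* con 1ℚ := y₁ :* x₁ :* con 1ℚ) refl x₁ y₁ H

      -- Convergents as weighted means

      Mean : ℕ → ℕ → Set
      Mean N m = WeightedMean S N (P a b m) (Q a b m)

      -- A combination valid for every solution gives numerator and denominator the same weights;
      -- with `s = 1` it says that the denominator is their sum.
      mean : ∀ {N m} i α β → N ℕ.≤ i → 0ℚ ≤ α → 0ℚ < β →
             (∀ {W s} → Solution W s → W m ≡ α * s i + β * s (suc i)) → Mean N m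
      mean i α β N≤i 0≤α 0<β combination = record
        { i = i ; α = α ; β = β ; N≤i = N≤i ; 0≤α = 0≤α ; 0<β = 0<β
        ; p≡ = combination P-solution
        ; q≡ = trans (combination Q-solution) (cong₂ _+_ (*-identityʳ α) (*-identityʳ β))
        }

      period-mean : ∀ j (r : Fin 3) → Mean j (3 ℕ.+ (toℕ r ℕ.+ j ℕ.* 3))
      period-mean j zero = mean
        (1 ℕ.+ j) (c j * H) ((g (1 ℕ.+ j) - 1ℚ) * (c j * x (2 ℕ.+ j)) + c j * y (1 ℕ.+ j))
        (ℕ.n≤1+n j) (<⇒≤ (0<* (c>0 j) H>0))
        (+-mono-≤-< (0≤* (0≤- (g≥1 (1 ℕ.+ j))) (<⇒≤ (0<* (c>0 j) (x>0 (2 ℕ.+ j)))))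
          (0<* (c>0 j) (y>0 (1 ℕ.+ j))))
        λ {_} {s} sol → trans (proj₁ (closed sol j))
          (solve 7 (λ g c x y H s s′ →
            (g :- con 1ℚ) :* (c :* x :* s′) :+ c :* (y :* s′ :+ H :* s) :=
            c :* H :* s :+ ((g :- con 1ℚ) :* (c :* x) :+ c :* y) :* s′) refl
            (g (1 ℕ.+ j)) (c j) (x (2 ℕ.+ j)) (y (1 ℕ.+ j)) H (s (1 ℕ.+ j)) (s (2 ℕ.+ j)))
      period-mean j (suc zero) = mean
        (2 ℕ.+ j) (c j * H) (c j * y (2 ℕ.+ j))
        (ℕ.m≤n+m j 2) (<⇒≤ (0<* (c>0 j) H>0)) (0<* (c>0 j) (y>0 (2 ℕ.+ j)))
        λ {_} {s} sol → trans (proj₁ (proj₂ (closed sol j)))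
          (solve 5 (λ c y H s s′ → c :* (y :* s′ :+ H :* s) := c :* H :* s :+ c :* y :* s′) refl
            (c j) (y (2 ℕ.+ j)) H (s (2 ℕ.+ j)) (s (3 ℕ.+ j)))
      period-mean j (suc (suc zero)) = mean
        -- The weight 0 reflects that the convergent at index `3k + 2` is exactly the partial sum
        -- `S (k + 2)`, where `k = j + 1`.
        (2 ℕ.+ j) 0ℚ (c (1 ℕ.+ j) * x (3 ℕ.+ j))
        (ℕ.m≤n+m j 2) ≤-refl (0<* (c>0 (1 ℕ.+ j)) (x>0 (3 ℕ.+ j)))
        λ {_} {s} sol → trans (proj₂ (proj₂ (closed sol j)))
          (solve 3 (λ d s s′ → d :* s′ := con 0ℚ :* s :+ d :* s′) refl
            (c (1 ℕ.+ j) * x (3 ℕ.+ j)) (s (2 ℕ.+ j)) (s (3 ℕ.+ j)))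

      -- Dividing `m - 3` by 3 yields the period and the position in it; the quotient is at least
      -- `N` by monotonicity of division.
      convergent-mean : ∀ N m → 3 ℕ.+ N ℕ.* 3 ℕ.≤ m → Mean N m
      convergent-mean N m 3+3N≤m = subst (Mean N) m≡
        (weightedMean-≤ N≤quotient (period-mean quotient remainder))
        where
          n = m ℕ.∸ 3
          open ℕ.DivMod (n ℕ.divMod 3)

          N≤quotient : N ℕ.≤ quotient
          N≤quotient = subst (ℕ._≤ quotient) (ℕ.m*n/n≡m N 3)
            (ℕ./-monoˡ-≤ 3 (ℕ.∸-monoˡ-≤ 3 3+3N≤m))

          m≡ : 3 ℕ.+ (toℕ remainder ℕ.+ quotient ℕ.* 3) ≡ m
          m≡ = trans (cong (3 ℕ.+_) (sym property))
            (ℕ.m+[n∸m]≡n (ℕ.≤-trans (ℕ.m≤m+n 3 (N ℕ.* 3)) 3+3N≤m))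

      Q≢0 : ∀ m → 3 ℕ.≤ m → Q a b m ≢ 0ℚ
      Q≢0 m 3≤m = 0<⇒≢0 (WeightedMean.q>0 (convergent-mean 0 m 3≤m))

mainTheorem5 : (F : ℕ → Poly₂) →
    (∀ n → NonzeroPoly (F n)) →
    (∀ n → eval₂ (F n) 0ℚ 0ℚ ≡ 0ℚ) →
    (x : ℕ → ℚ) → IsRecurrence F x →
    (h : ℕ) → 0 ℕ.< h →
    (a b : ℕ → ℚ) → IsExpansion F x h a b →
    ∃[ T ] (HasSum (λ n → (- 1ℚ) ^ n * (fromℕ h ^ n ⊘ x (1 ℕ.+ n))) T × HasCFValue a b T)
mainTheorem5 F F≢0 F₀₀ x R h 0<h a b E =
  -- The real `T` is represented by the partial sums themselves, so they converge to it at once, and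
  -- the convergents follow as weighted means.
  limit S′ cauchy , ⟶-limit S′ cauchy ,
  (3 , Q≢0 F≢0 F₀₀ R 0<h E) ,
  weightedMeans-⟶ S′ (P a b) (Q a b) (λ N → 3 ℕ.+ N ℕ.* 3) (convergent-mean F≢0 F₀₀ R 0<h E) cauchy
  where
    S′ = S F≢0 F₀₀ R 0<h
    cauchy = S-cauchy F≢0 F₀₀ R 0<h
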